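{- Consider POWERSET SALIQUOT. Then $\mathcal{SG}(0)=0$, and $\mathcal{SG}(n)=2^p$, if $2^p$ is largest power of two divisor of $n\ge 1$.
   Context: POWERSET SALIQUOT is the impartial normal-play game on nonnegative integer heaps where from a heap $n\ge1$ a player chooses any nonempty set $S$ of positive divisors of $n$ and moves to the disjunctive sum of the heaps $n-d$, $d\in S$; the heap $0$ is terminal. $\mathcal{SG}$ denotes the Sprague-Grundy value (mex rule, nim-sum). -}

module Defs where

open import Data.List.Base using (List; []; _∷_; [_]; _++_; map; filter; applyUpTo)
open import Data.List.Extrema.Nat using (max; xs≤max)
open import Data.List.Membership.Propositional using (_∈_; _∉_; mapWith∈)
open import Data.List.Membership.Propositional.Properties using (∈-map⁻; ∈-++⁻; mapWith∈-cong; mapWith∈≗map)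
open import Data.List.Properties using (map-∘; map-applyUpTo; map-++)
open import Data.List.Relation.Unary.All using (lookup)
open import Data.List.Relation.Unary.Any using (here; there)
open import Data.Nat.Base using (ℕ; zero; suc; _+_; _∸_; _^_; _≤_; _<_; z≤n)
open import Data.Nat.Divisibility using (_∣?_)
open import Data.Nat.Induction using (<-wellFounded)
open import Data.Nat.ListAction using (sum)
open import Data.Nat.ListAction.Properties using (sum-++)
open import Data.Nat.Properties using (_≟_; +-suc; m≤m+n; m≤n+m; n<1+n; <⇒≱; m<1+n⇒m<n∨m≡n; ≤-trans; <-≤-trans; +-monoʳ-≤; +-monoʳ-<; +-monoˡ-<; module ≤-Reasoning)
open import Data.Product.Base using (_,_)
open import Data.Sum.Base using (inj₁; inj₂)
open import Induction.WellFounded using (Acc; acc; WellFounded; module Subrelation)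
open import Relation.Binary.Construct.On as On using ()
open import Relation.Binary.PropositionalEquality using (_≡_; refl; sym; trans; cong; subst)
open import Relation.Nullary.Decidable.Core using (yes; no)
open import Relation.Unary using (Decidable)
open import Data.List.Membership.DecPropositional _≟_ using (_∈?_)

mexFrom : (fuel start : ℕ) → List ℕ → ℕ
mexFrom zero    m xs = m
mexFrom (suc k) m xs with m ∈? xs
... | yes _ = mexFrom k (suc m) xs
... | no  _ = m

-- The fuel always suffices, because suc (max 0 xs) ∉ xs; mex-∉ and <mex⇒∈
-- show that mex xs is the least natural number not in xs.
mex : List ℕ → ℕ
mex xs = mexFrom (suc (max 0 xs)) 0 xs

mexFrom-∉ : ∀ k m xs → max 0 xs < k + m → mexFrom k m xs ∉ xs
mexFrom-∉ zero m xs max<m m∈xs =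
  <⇒≱ max<m (lookup (xs≤max 0 xs) m∈xs)
mexFrom-∉ (suc k) m xs max<k+m with m ∈? xs
... | yes _    = mexFrom-∉ k (suc m) xs (subst (max 0 xs <_) (sym (+-suc k m)) max<k+m)
... | no  m∉xs = m∉xs

<mexFrom⇒∈ : ∀ k m xs → (∀ {i} → i < m → i ∈ xs) → ∀ {i} → i < mexFrom k m xs → i ∈ xs
<mexFrom⇒∈ zero    m xs below = below
<mexFrom⇒∈ (suc k) m xs below with m ∈? xs
... | no  _    = below
... | yes m∈xs = <mexFrom⇒∈ k (suc m) xs below′
  where
  below′ : ∀ {i} → i < suc m → i ∈ xs
  below′ i<1+m with m<1+n⇒m<n∨m≡n i<1+m
  ... | inj₁ i<m  = below i<m
  ... | inj₂ refl = m∈xs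

mex-∉ : ∀ xs → mex xs ∉ xs
mex-∉ xs = mexFrom-∉ (suc (max 0 xs)) 0 xs (m≤m+n _ 0)

<mex⇒∈ : ∀ xs {i} → i < mex xs → i ∈ xs
<mex⇒∈ xs = <mexFrom⇒∈ (suc (max 0 xs)) 0 xs (λ ())

-- A position is a disjunctive sum of heaps, given by the list of its heaps.
Position : Set
Position = List ℕ

-- For n ≥ 1: the positive divisors of n, without repetition.
divisors : ℕ → List ℕ
divisors n = filter (_∣? n) (applyUpTo suc n)

-- On a list without repetitions these are its nonempty subsets, each once.
nonemptySublists : ∀ {A : Set} → List A → List (List A)
nonemptySublists []       = []
nonemptySublists (x ∷ xs) =
  [ x ] ∷ map (x ∷_) (nonemptySublists xs) ++ nonemptySublists xs

heapOptions : ℕ → List Position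
heapOptions zero      = []
heapOptions n@(suc _) = map (map (n ∸_)) (nonemptySublists (divisors n))

-- A move in a disjunctive sum is a move in exactly one of its components.
options : Position → List Position
options []       = []
options (n ∷ hs) = map (_++ hs) (heapOptions n) ++ map (n ∷_) (options hs)

-- Termination: the sum of 2 ^ h over all heaps h decreases with every
-- move, since the divisors d used in a move are distinct.
weight : Position → ℕ
weight p = sum (map (2 ^_) p)

weight-++ : ∀ p q → weight (p ++ q) ≡ weight p + weight q
weight-++ p q = trans (cong sum (map-++ (2 ^_) p q)) (sum-++ (map (2 ^_) p) _)

sum-sublist-≤ : ∀ {A : Set} (f : A → ℕ) xs {ys} → ys ∈ nonemptySublists xs →
                sum (map f ys) ≤ sum (map f xs)
sum-sublist-≤ f (x ∷ xs) (here refl) = +-monoʳ-≤ (f x) z≤n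
sum-sublist-≤ f (x ∷ xs) (there ys∈) with ∈-++⁻ (map (x ∷_) (nonemptySublists xs)) ys∈
... | inj₂ ys∈xs = ≤-trans (sum-sublist-≤ f xs ys∈xs) (m≤n+m _ (f x))
... | inj₁ ys∈map with ∈-map⁻ (x ∷_) ys∈map
...   | _ , zs∈xs , refl = +-monoʳ-≤ (f x) (sum-sublist-≤ f xs zs∈xs)

sum-filter-≤ : ∀ {A : Set} {P : A → Set} (P? : Decidable P) (f : A → ℕ) xs →
               sum (map f (filter P? xs)) ≤ sum (map f xs)
sum-filter-≤ P? f []       = z≤n
sum-filter-≤ P? f (x ∷ xs) with P? x
... | yes _ = +-monoʳ-≤ (f x) (sum-filter-≤ P? f xs)
... | no  _ = ≤-trans (sum-filter-≤ P? f xs) (m≤n+m _ (f x))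

geometric : ∀ n → sum (applyUpTo (λ k → 2 ^ (n ∸ suc k)) n) < 2 ^ n
geometric zero    = n<1+n 0
geometric (suc n) =
  +-monoʳ-< (2 ^ n) (<-≤-trans (geometric n) (m≤m+n (2 ^ n) 0))

heapOptions-weight : ∀ n {q} → q ∈ heapOptions n → weight q < 2 ^ n
heapOptions-weight n@(suc _) q∈ with ∈-map⁻ (map (n ∸_)) q∈
... | S , S∈ , refl = begin-strict
  sum (map (2 ^_) (map (n ∸_) S))      ≡⟨ cong sum (map-∘ S) ⟨
  sum (map f S)                        ≤⟨ sum-sublist-≤ f (divisors n) S∈ ⟩
  sum (map f (divisors n))             ≤⟨ sum-filter-≤ (_∣? n) f (applyUpTo suc n) ⟩
  sum (map f (applyUpTo suc n))        ≡⟨ cong sum (map-applyUpTo suc f n) ⟩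
  sum (applyUpTo (λ k → f (suc k)) n)  <⟨ geometric n ⟩
  2 ^ n                                ∎
  where
  open ≤-Reasoning
  f : ℕ → ℕ
  f d = 2 ^ (n ∸ d)

options-weight : ∀ p {q} → q ∈ options p → weight q < weight p
options-weight (n ∷ hs) q∈ with ∈-++⁻ (map (_++ hs) (heapOptions n)) q∈
... | inj₁ q∈ˡ with ∈-map⁻ (_++ hs) q∈ˡ
...   | r , r∈ , refl =
  subst (_< 2 ^ n + weight hs) (sym (weight-++ r hs))
        (+-monoˡ-< (weight hs) (heapOptions-weight n r∈))
options-weight (n ∷ hs) q∈ | inj₂ q∈ʳ with ∈-map⁻ (n ∷_) q∈ʳ
... | _ , r∈ , refl = +-monoʳ-< (2 ^ n) (options-weight hs r∈)

_isOptionOf_ : Position → Position → Set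
q isOptionOf p = q ∈ options p

isOptionOf-wellFounded : WellFounded _isOptionOf_
isOptionOf-wellFounded =
  Subrelation.wellFounded (λ {q} {p} → options-weight p)
    (On.wellFounded weight <-wellFounded)

SG-acc : ∀ p → Acc _isOptionOf_ p → ℕ
SG-acc p (acc rs) = mex (mapWith∈ (options p) (λ {q} q∈ → SG-acc q (rs q∈)))

-- The mex rule (SG-mex) defines SG on all sums of heaps; that SG of a sum is
-- the nim-sum of the values of its components is a consequence, not assumed.
SG : Position → ℕ
SG p = SG-acc p (isOptionOf-wellFounded p)

SG-acc-irrelevant : ∀ p (a b : Acc _isOptionOf_ p) → SG-acc p a ≡ SG-acc p b
SG-acc-irrelevant p (acc rs) (acc rs′) =
  cong mex (mapWith∈-cong (options p) _ _
    (λ {q} q∈ → SG-acc-irrelevant q (rs q∈) (rs′ q∈)))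

SG-acc-mex : ∀ p (a : Acc _isOptionOf_ p) → SG-acc p a ≡ mex (map SG (options p))
SG-acc-mex p (acc rs) = cong mex (trans
  (mapWith∈-cong (options p) _ _
    (λ {q} q∈ → SG-acc-irrelevant q (rs q∈) (isOptionOf-wellFounded q)))
  (mapWith∈≗map SG (options p)))

SG-mex : ∀ p → SG p ≡ mex (map SG (options p))
SG-mex p = SG-acc-mex p (isOptionOf-wellFounded p)

{-# OPTIONS --safe #-}
-- Let v be the 2-adic valuation, and give a position the value whose k-th
-- binary digit is the parity of the number of heaps h with v(h) = k, that is,
-- the nim-sum of the claimed heap values (the heap 0 contributes nothing).
-- A move at a heap n with v(n) = t creates no heap of valuation t: if n = qd,
-- then n − d = (q − 1)d, and if 2^t divides n and n − d, it divides d, so that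
-- 2^(t+1) divides qd or (q − 1)d, one of q, q − 1 being even. Hence every move
-- changes digit t.
-- Conversely, v(n − 2^j) = j for j < t, so a suitable choice of powers of two
-- (or of d = n, if no lower digit is to change) removes digit t and toggles any
-- prescribed set of lower digits; this reaches every smaller value, because
-- at the leading digit where the values differ the present one has a 1.
module Submission where

open import Defs
open import Data.Bool.Base using (Bool; true; false; not; _xor_; if_then_else_)
open import Data.Bool.Properties using (xor-assoc; xor-comm; xor-identityʳ; xor-same; xor-inverseʳ; not-injective) renaming (_≟_ to _≟ᵇ_)
open import Data.List.Base using (List; []; _∷_; [_]; _++_; map; filter; foldr; applyUpTo)
open import Data.List.Membership.Propositional using (_∈_; _∉_)
open import Data.List.Membership.Propositional.Properties using (∈-map⁺; ∈-map⁻; ∈-++⁺ˡ; ∈-++⁺ʳ; ∈-++⁻; ∈-filter⁺; ∈-filter⁻; ∈-applyUpTo⁺)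
open import Data.List.Properties using (foldr-map)
open import Data.List.Relation.Unary.All as All using (All; []; _∷_)
open import Data.List.Relation.Unary.All.Properties using (++⁺)
open import Data.List.Relation.Unary.AllPairs using (_∷_)
open import Data.List.Relation.Unary.Any using (here; there)
open import Data.List.Relation.Unary.Unique.Propositional using (Unique)
open import Data.List.Relation.Unary.Unique.Propositional.Properties using (applyUpTo⁺₁; filter⁺)
open import Data.Nat.Base using (ℕ; zero; suc; _+_; _*_; _∸_; _^_; _≤_; _<_; z≤n; s≤s; NonZero; >-nonZero)
open import Data.Nat.Divisibility using (_∣_; _∣?_; divides; 1∣_; _∣0; ∣-refl; ∣-trans; ∣⇒≤; >⇒∤; ∣m+n∣m⇒∣n; ∣m∣n⇒∣m+n; *-pres-∣)
open import Data.Nat.Properties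
open import Data.Product.Base using (∃-syntax; _×_; _,_; proj₁; proj₂)
open import Data.Sum.Base using (_⊎_; inj₁; inj₂)
open import Function.Base using (_∘_)
open import Induction.WellFounded using (Acc; acc)
open import Relation.Binary.Definitions using (tri<; tri≈; tri>)
open import Relation.Binary.PropositionalEquality using (_≡_; _≢_; refl; sym; trans; cong; cong₂; subst; module ≡-Reasoning)
open import Relation.Nullary.Decidable using (yes; no; does; dec-true; dec-false; ¬?; _×-dec_)
open import Relation.Nullary.Negation using (¬_; contradiction)
open import Relation.Unary using (Decidable)

-- Minimal excluded values and sublists

mex-unique : ∀ {xs m} → m ∉ xs → (∀ {i} → i < m → i ∈ xs) → mex xs ≡ m
mex-unique {xs} {m} m∉xs below with <-cmp (mex xs) m
... | tri< mex<m _ _ = contradiction (below mex<m) (mex-∉ xs)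
... | tri≈ _ mex≡m _ = mex≡m
... | tri> _ _ m<mex = contradiction (<mex⇒∈ xs m<mex) m∉xs

nonemptySublists-⊆ : ∀ {A : Set} (xs : List A) {ys} → ys ∈ nonemptySublists xs →
                     ∀ {y} → y ∈ ys → y ∈ xs
nonemptySublists-⊆ (x ∷ xs) (here refl) (here refl) = here refl
nonemptySublists-⊆ (x ∷ xs) (there ys∈) y∈ with ∈-++⁻ (map (x ∷_) (nonemptySublists xs)) ys∈
... | inj₂ ys∈xs = there (nonemptySublists-⊆ xs ys∈xs y∈)
... | inj₁ ys∈map with ∈-map⁻ (x ∷_) ys∈map | y∈
...   | _ , _     , refl | here refl  = here refl
...   | _ , zs∈xs , refl | there y∈zs = there (nonemptySublists-⊆ xs zs∈xs y∈zs)

singleton∈nonemptySublists : ∀ {A : Set} {x : A} {xs} → x ∈ xs → [ x ] ∈ nonemptySublists xs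
singleton∈nonemptySublists (here refl) = here refl
singleton∈nonemptySublists {xs = y ∷ xs} (there x∈xs) =
  there (∈-++⁺ʳ (map (y ∷_) (nonemptySublists xs)) (singleton∈nonemptySublists x∈xs))

-- Needed to recognise a filtered list of divisors as a legal choice; the empty outcome is no move
-- and stays a separate case.
filter∈nonemptySublists : ∀ {A : Set} {P : A → Set} (P? : Decidable P) xs →
                          filter P? xs ≡ [] ⊎ filter P? xs ∈ nonemptySublists xs
filter∈nonemptySublists P? [] = inj₁ refl
filter∈nonemptySublists P? (x ∷ xs) with P? x | filter∈nonemptySublists P? xs
... | yes _ | inj₁ eq  = inj₂ (here (cong (x ∷_) eq))
... | yes _ | inj₂ ys∈ = inj₂ (there (∈-++⁺ˡ (∈-map⁺ (x ∷_) ys∈)))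
... | no _  | inj₁ eq  = inj₁ eq
... | no _  | inj₂ ys∈ = inj₂ (there (∈-++⁺ʳ (map (x ∷_) (nonemptySublists xs)) ys∈))

-- Parity of the number of list elements satisfying a predicate

module _ {A : Set} {P : A → Set} (P? : Decidable P) where

  parity : List A → Bool
  parity = foldr (λ x b → does (P? x) xor b) false

  parity-++ : ∀ xs ys → parity (xs ++ ys) ≡ parity xs xor parity ys
  parity-++ []       ys = refl
  parity-++ (x ∷ xs) ys =
    trans (cong (does (P? x) xor_) (parity-++ xs ys))
          (sym (xor-assoc (does (P? x)) (parity xs) (parity ys)))

  parity-none : ∀ xs → (∀ {x} → x ∈ xs → ¬ P x) → parity xs ≡ false
  parity-none []       none = refl
  parity-none (x ∷ xs) none =
    cong₂ _xor_ (dec-false (P? x) (none (here refl))) (parity-none xs (none ∘ there))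

  -- `Unique` guarantees that the only element satisfying `P` is counted once.
  parity-one : ∀ {x xs} → Unique xs → x ∈ xs → P x → (∀ {y} → y ∈ xs → P y → y ≡ x) →
               parity xs ≡ true
  parity-one {xs = x ∷ xs} (x∉xs ∷ _) (here refl) Px only =
    cong₂ _xor_ (dec-true (P? x) Px)
      (parity-none xs λ y∈ Py → All.lookup x∉xs y∈ (sym (only (there y∈) Py)))
  parity-one {xs = y ∷ xs} (y∉xs ∷ uniq) (there x∈xs) Px only =
    cong₂ _xor_ (dec-false (P? y) λ Py → All.lookup y∉xs x∈xs (only (here refl) Py))
      (parity-one uniq x∈xs Px (only ∘ there))

-- Binary digits

fromBits : ℕ → (ℕ → Bool) → ℕ
fromBits zero    f = 0
fromBits (suc K) f = if f K then 2 ^ K + fromBits K f else fromBits K f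

fromBits-cong : ∀ K {f g} → (∀ {k} → k < K → f k ≡ g k) → fromBits K f ≡ fromBits K g
fromBits-cong zero    f≗g = refl
fromBits-cong (suc K) f≗g
  rewrite f≗g (n<1+n K) | fromBits-cong K (f≗g ∘ m<n⇒m<1+n) = refl

2^-suc : ∀ k → 2 ^ suc k ≡ 2 ^ k + 2 ^ k
2^-suc k = cong (2 ^ k +_) (+-identityʳ (2 ^ k))

2^-nonZero : ∀ k → NonZero (2 ^ k)
2^-nonZero k = m^n≢0 2 k

2^-<-suc : ∀ k → 2 ^ k < 2 ^ suc k
2^-<-suc k = ^-monoʳ-< 2 (n<1+n 1) (n<1+n k)

fromBits-< : ∀ K f → fromBits K f < 2 ^ K
fromBits-< zero    f = n<1+n 0
fromBits-< (suc K) f with f K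
... | true  = subst (2 ^ K + fromBits K f <_) (sym (2^-suc K)) (+-monoʳ-< (2 ^ K) (fromBits-< K f))
... | false = <-trans (fromBits-< K f) (2^-<-suc K)

-- If the top digits differed, the number with top digit 1 would be at least `2 ^ K` and the other
-- one below it, by `fromBits-<`.
fromBits-injective : ∀ K {f g} → fromBits K f ≡ fromBits K g → ∀ {k} → k < K → f k ≡ g k
fromBits-injective (suc K) {f} {g} eq {k} k<1+K
  with f K in fK | g K in gK | m<1+n⇒m<n∨m≡n k<1+K
... | true  | true  | inj₁ k<K  = fromBits-injective K (+-cancelˡ-≡ (2 ^ K) _ _ eq) k<K
... | false | false | inj₁ k<K  = fromBits-injective K eq k<K
... | true  | true  | inj₂ refl = trans fK (sym gK)
... | false | false | inj₂ refl = trans fK (sym gK)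
... | true  | false | _ =
  contradiction (subst (_< 2 ^ K) (sym eq) (fromBits-< K g)) (≤⇒≯ (m≤m+n (2 ^ K) _))
... | false | true  | _ =
  contradiction (subst (_< 2 ^ K) eq (fromBits-< K f)) (≤⇒≯ (m≤m+n (2 ^ K) _))

fromBits-zero : ∀ K {f} → (∀ {k} → k < K → f k ≡ false) → fromBits K f ≡ 0
fromBits-zero zero    f≗0 = refl
fromBits-zero (suc K) f≗0 rewrite f≗0 (n<1+n K) = fromBits-zero K (f≗0 ∘ m<n⇒m<1+n)

fromBits-single : ∀ K {f p} → p < K → f p ≡ true → (∀ {k} → k ≢ p → f k ≡ false) →
                  fromBits K f ≡ 2 ^ p
fromBits-single (suc K) {f} {p} p<1+K fp others with m<1+n⇒m<n∨m≡n p<1+K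
... | inj₁ p<K rewrite others (>⇒≢ p<K) = fromBits-single K p<K fp others
... | inj₂ refl rewrite fp =
  trans (cong (2 ^ K +_) (fromBits-zero K (others ∘ <⇒≢))) (+-identityʳ (2 ^ K))

-- Toggling digits to reach a prescribed number

_[_↦_] : (ℕ → Bool) → ℕ → Bool → ℕ → Bool
(c [ K ↦ b ]) k = if does (k ≟ K) then b else c k

update-same : ∀ c K b → (c [ K ↦ b ]) K ≡ b
update-same c K b rewrite dec-true (K ≟ K) refl = refl

update-other : ∀ c {K b k} → k ≢ K → (c [ K ↦ b ]) k ≡ c k
update-other c {K} {b} {k} k≢K rewrite dec-false (k ≟ K) k≢K = refl

_⊕_ : (ℕ → Bool) → (ℕ → Bool) → ℕ → Bool
(g ⊕ c) k = g k xor c k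

fromBits-update : ∀ K g c b → fromBits K (g ⊕ (c [ K ↦ b ])) ≡ fromBits K (g ⊕ c)
fromBits-update K g c b = fromBits-cong K λ {k} k<K → cong (g k xor_) (update-other c (<⇒≢ k<K))

-- From the top digit down: comparing `x` with `2 ^ K` gives digit `K` of `x`, and `c K` is its xor
-- with `g K`. The vanishing of `c` from `K` on keeps a later choice of leading digit intact.
toggle-to : ∀ K g {x} → x < 2 ^ K → ∃[ c ] fromBits K (g ⊕ c) ≡ x × (∀ {k} → K ≤ k → c k ≡ false)
toggle-to zero    g {zero} _ = (λ _ → false) , refl , λ _ → refl
toggle-to zero    g {suc _} (s≤s ())
toggle-to (suc K) g {x} x<2^1+K with x <? 2 ^ K
... | yes x<2^K = let c , eq , c≗0 = toggle-to K g x<2^K in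
  c [ K ↦ g K ] , sum-eq c eq , λ K<k → trans (update-other c (>⇒≢ K<k)) (c≗0 (<⇒≤ K<k))
  where
  sum-eq : ∀ c → fromBits K (g ⊕ c) ≡ x → fromBits (suc K) (g ⊕ (c [ K ↦ g K ])) ≡ x
  sum-eq c eq rewrite update-same c K (g K) | xor-same (g K) = trans (fromBits-update K g c (g K)) eq
... | no x≮2^K = let c , eq , c≗0 = toggle-to K g rest< in
  c [ K ↦ not (g K) ] , sum-eq c eq , λ K<k → trans (update-other c (>⇒≢ K<k)) (c≗0 (<⇒≤ K<k))
  where
  2^K≤x : 2 ^ K ≤ x
  2^K≤x = ≮⇒≥ x≮2^K
  rest< : x ∸ 2 ^ K < 2 ^ K
  rest< = +-cancelˡ-< (2 ^ K) _ _
    (subst (_< 2 ^ K + 2 ^ K) (sym (m+[n∸m]≡n 2^K≤x)) (subst (x <_) (2^-suc K) x<2^1+K))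
  sum-eq : ∀ c → fromBits K (g ⊕ c) ≡ x ∸ 2 ^ K →
           fromBits (suc K) (g ⊕ (c [ K ↦ not (g K) ])) ≡ x
  sum-eq c eq rewrite update-same c K (not (g K)) | xor-inverseʳ (g K) =
    trans (cong (2 ^ K +_) (trans (fromBits-update K g c (not (g K))) eq)) (m+[n∸m]≡n 2^K≤x)

LeadingAt : (ℕ → Bool) → ℕ → Set
LeadingAt c t = c t ≡ true × (∀ {k} → t < k → c k ≡ false)

-- The argument known from Nim: `t` is the highest place where `g` and the digits of `x` differ, and
-- `x` being smaller forces a 1 of `g` there.
toggle-to-smaller : ∀ K g {x} → x < fromBits K g →
  ∃[ t ] ∃[ c ] g t ≡ true × LeadingAt c t × t < K × fromBits K (g ⊕ c) ≡ x
toggle-to-smaller (suc K) g {x} x< with g K in gK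
... | false = let t , c , gt , lead , t<K , eq = toggle-to-smaller K g x< in
  t , c , gt , lead , m<n⇒m<1+n t<K , sum-eq c (proj₂ lead t<K) eq
  where
  sum-eq : ∀ c → c K ≡ false → fromBits K (g ⊕ c) ≡ x →
           (if c K then 2 ^ K + fromBits K (g ⊕ c) else fromBits K (g ⊕ c)) ≡ x
  sum-eq c cK eq rewrite cK = eq
... | true with x <? 2 ^ K
-- Here `x` lacks the digit `K` that `g` has, so `K` is the leading difference and the lower digits
-- are free.
...   | yes x<2^K = let c , eq , c≗0 = toggle-to K g x<2^K in
  K , c [ K ↦ true ] , gK ,
  (update-same c K true , λ K<k → trans (update-other c (>⇒≢ K<k)) (c≗0 (<⇒≤ K<k))) ,
  n<1+n K , sum-eq c eq
  where
  sum-eq : ∀ c → fromBits K (g ⊕ c) ≡ x → let f = g ⊕ (c [ K ↦ true ]) in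
           (if not ((c [ K ↦ true ]) K) then 2 ^ K + fromBits K f else fromBits K f) ≡ x
  sum-eq c eq rewrite update-same c K true = trans (fromBits-update K g c true) eq
-- Both have digit `K`, so it is subtracted from both sides and the leading difference lies lower.
...   | no x≮2^K = let t , c , gt , lead , t<K , eq = toggle-to-smaller K g rest< in
  t , c , gt , lead , m<n⇒m<1+n t<K , sum-eq c (proj₂ lead t<K) eq
  where
  2^K≤x : 2 ^ K ≤ x
  2^K≤x = ≮⇒≥ x≮2^K
  rest< : x ∸ 2 ^ K < fromBits K g
  rest< = +-cancelˡ-< (2 ^ K) _ _ (subst (_< 2 ^ K + fromBits K g) (sym (m+[n∸m]≡n 2^K≤x)) x<)
  sum-eq : ∀ c → c K ≡ false → fromBits K (g ⊕ c) ≡ x ∸ 2 ^ K →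
           (if not (c K) then 2 ^ K + fromBits K (g ⊕ c) else fromBits K (g ⊕ c)) ≡ x
  sum-eq c cK eq rewrite cK = trans (cong (2 ^ K +_) eq) (m+[n∸m]≡n 2^K≤x)

-- The 2-adic valuation

-- No k satisfies this for h = 0.
HasValuation : ℕ → ℕ → Set
HasValuation k h = 2 ^ k ∣ h × ¬ 2 ^ suc k ∣ h

hasValuation? : ∀ k → Decidable (HasValuation k)
hasValuation? k h = (2 ^ k ∣? h) ×-dec ¬? (2 ^ suc k ∣? h)

hasValuation⇒>0 : ∀ {k h} → HasValuation k h → 1 ≤ h
hasValuation⇒>0 {k} {zero}  (_ , ∤0) = contradiction ((2 ^ suc k) ∣0) ∤0
hasValuation⇒>0 {k} {suc _} _        = s≤s z≤n

2^-mono-∣ : ∀ {j k} → j ≤ k → 2 ^ j ∣ 2 ^ k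
2^-mono-∣ {k = k} z≤n = 1∣ (2 ^ k)
2^-mono-∣ (s≤s j≤k)   = *-pres-∣ (∣-refl {2}) (2^-mono-∣ j≤k)

hasValuation-unique : ∀ {j k h} → HasValuation j h → HasValuation k h → j ≡ k
hasValuation-unique {j} {k} (j∣ , j∤) (k∣ , k∤) with <-cmp j k
... | tri< j<k _ _ = contradiction (∣-trans (2^-mono-∣ j<k) k∣) j∤
... | tri≈ _ j≡k _ = j≡k
... | tri> _ _ k<j = contradiction (∣-trans (2^-mono-∣ k<j) j∣) k∤

-- Descending from `K`, the first power of two that divides `n` is followed by one already known not
-- to.
hasValuation-exists : ∀ K {n} → ¬ 2 ^ K ∣ n → ∃[ p ] p < K × HasValuation p n
hasValuation-exists zero    {n} ∤n = contradiction (1∣ n) ∤n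
hasValuation-exists (suc K) {n} ∤n with 2 ^ K ∣? n
... | yes ∣n = K , n<1+n K , ∣n , ∤n
... | no ∤n′ = let p , p<K , v = hasValuation-exists K ∤n′ in p , m<n⇒m<1+n p<K , v

-- Both `n` and `2 ^ j` are multiples of `2 ^ j`, but of the two only `n` is a multiple of
-- `2 ^ suc j`.
hasValuation-∸2^ : ∀ {j t n} → j < t → 2 ^ j ≤ n → 2 ^ t ∣ n → HasValuation j (n ∸ 2 ^ j)
hasValuation-∸2^ {j} {t} {n} j<t 2^j≤n t∣n =
  ∣m+n∣m⇒∣n (subst (2 ^ j ∣_) n≡ (∣-trans (2^-mono-∣ (<⇒≤ j<t)) t∣n)) ∣-refl ,
  λ 1+j∣ → >⇒∤ {{2^-nonZero j}} (2^-<-suc j)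
    (∣m+n∣m⇒∣n (subst (2 ^ suc j ∣_) (trans n≡ (+-comm (2 ^ j) _))
                 (∣-trans (2^-mono-∣ j<t) t∣n)) 1+j∣)
  where
  n≡ : n ≡ 2 ^ j + (n ∸ 2 ^ j)
  n≡ = sym (m+[n∸m]≡n 2^j≤n)

2∣n⊎2∣1+n : ∀ n → 2 ∣ n ⊎ 2 ∣ suc n
2∣n⊎2∣1+n zero    = inj₁ (2 ∣0)
2∣n⊎2∣1+n (suc n) with 2∣n⊎2∣1+n n
... | inj₁ 2∣n   = inj₂ (∣m∣n⇒∣m+n (∣-refl {2}) 2∣n)
... | inj₂ 2∣1+n = inj₁ 2∣1+n

¬hasValuation-∸divisor : ∀ {p n d} → d ∣ n → HasValuation p n → ¬ HasValuation p (n ∸ d)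
¬hasValuation-∸divisor {p} (divides zero refl) (_ , ∤n) _ = ∤n ((2 ^ suc p) ∣0)
¬hasValuation-∸divisor {p} {d = d} (divides (suc q) refl) (∣n , ∤n) v
  -- For `n = (1 + q) * d` the remaining heap is `q * d`; as `2 ^ p` divides both, it divides `d`,
  -- and the even one of `q` and `1 + q` supplies another factor 2.
  with subst (HasValuation p) (m+n∸m≡n d (q * d)) v
... | ∣qd , ∤qd with 2∣n⊎2∣1+n q | ∣m+n∣m⇒∣n (subst (2 ^ p ∣_) (+-comm d (q * d)) ∣n) ∣qd
...   | inj₁ 2∣q   | ∣d = ∤qd (*-pres-∣ 2∣q ∣d)
...   | inj₂ 2∣1+q | ∣d = ∤n (*-pres-∣ 2∣1+q ∣d)

-- Moves

digits : Position → ℕ → Bool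
digits p k = parity (hasValuation? k) p

digits-++ : ∀ p q k → digits (p ++ q) k ≡ digits p k xor digits q k
digits-++ p q k = parity-++ (hasValuation? k) p q

∈-divisors⁺ : ∀ {d n} → 1 ≤ d → 1 ≤ n → d ∣ n → d ∈ divisors n
∈-divisors⁺ {suc d} {n@(suc _)} _ _ d∣n = ∈-filter⁺ (_∣? n) (∈-applyUpTo⁺ suc (∣⇒≤ d∣n)) d∣n

∈-divisors⁻ : ∀ {d n} → d ∈ divisors n → d ∣ n
∈-divisors⁻ {n = n} d∈ = proj₂ (∈-filter⁻ (_∣? n) {xs = applyUpTo suc n} d∈)

divisors-unique : ∀ n → Unique (divisors n)
divisors-unique n = filter⁺ (_∣? n) (applyUpTo⁺₁ suc n λ i<j _ → <⇒≢ i<j ∘ suc-injective)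

∈-heapOptions⁺ : ∀ {n S} → 1 ≤ n → S ∈ nonemptySublists (divisors n) → map (n ∸_) S ∈ heapOptions n
∈-heapOptions⁺ {n@(suc _)} _ S∈ = ∈-map⁺ (map (n ∸_)) S∈

∈-heapOptions⁻ : ∀ n {r h} → r ∈ heapOptions n → h ∈ r → ∃[ d ] d ∣ n × h ≡ n ∸ d
∈-heapOptions⁻ n@(suc _) r∈ h∈ with ∈-map⁻ (map (n ∸_)) r∈
... | S , S∈ , refl with ∈-map⁻ (n ∸_) h∈
...   | d , d∈S , h≡ = d , ∈-divisors⁻ (nonemptySublists-⊆ (divisors n) S∈ d∈S) , h≡

heapOptions-clears : ∀ {n p r} → HasValuation p n → r ∈ heapOptions n → digits r p ≡ false
heapOptions-clears {n} {p} {r} v r∈ = parity-none (hasValuation? p) r none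
  where
  none : ∀ {h} → h ∈ r → ¬ HasValuation p h
  none h∈ with ∈-heapOptions⁻ n r∈ h∈
  ... | d , d∣n , refl = ¬hasValuation-∸divisor {p} d∣n v

-- A move at one heap with prescribed effect on the digits

module _ {n t : ℕ} (v : HasValuation t n) (c : ℕ → Bool) where

  -- Each `2 ^ j` leaves a heap of valuation `j` and so toggles digit `j`. As a predicate on
  -- divisors it makes the choice a sublist of `divisors n` by filtering.
  Chosen : ℕ → Set
  Chosen d = ∃[ j ] j < t × d ≡ 2 ^ j × c j ≡ true

  chosen? : Decidable Chosen
  chosen? d = anyUpTo? (λ j → (d ≟ 2 ^ j) ×-dec (c j ≟ᵇ true)) t

  chosen : List ℕ
  chosen = filter chosen? (divisors n)

  private
    n>0 : 1 ≤ n
    n>0 = hasValuation⇒>0 {t} v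

    2^j∣n : ∀ {j} → j < t → 2 ^ j ∣ n
    2^j∣n j<t = ∣-trans (2^-mono-∣ (<⇒≤ j<t)) (proj₁ v)

    valuation-left : ∀ {j} → j < t → HasValuation j (n ∸ 2 ^ j)
    valuation-left j<t = hasValuation-∸2^ j<t (∣⇒≤ {{>-nonZero n>0}} (2^j∣n j<t)) (proj₁ v)

  digits-chosen-true : ∀ {k} → k < t → c k ≡ true → digits (map (n ∸_) chosen) k ≡ true
  digits-chosen-true {k} k<t ck =
    trans (foldr-map _ (n ∸_) false chosen)
      (parity-one (hasValuation? k ∘ (n ∸_)) (filter⁺ chosen? (divisors-unique n))
        (∈-filter⁺ chosen? (∈-divisors⁺ (m^n>0 2 k) n>0 (2^j∣n k<t)) (k , k<t , refl , ck))
        (valuation-left k<t) only)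
    where
    only : ∀ {d} → d ∈ chosen → HasValuation k (n ∸ d) → d ≡ 2 ^ k
    only d∈ w with ∈-filter⁻ chosen? {xs = divisors n} d∈
    ... | _ , j , j<t , refl , _ = cong (2 ^_) (hasValuation-unique {j} {k} (valuation-left j<t) w)

  digits-chosen-false : ∀ {k} → ¬ (k < t × c k ≡ true) → digits (map (n ∸_) chosen) k ≡ false
  digits-chosen-false {k} ¬ck = parity-none (hasValuation? k) _ none
    where
    none : ∀ {h} → h ∈ map (n ∸_) chosen → ¬ HasValuation k h
    none h∈ w with ∈-map⁻ (n ∸_) h∈
    ... | d , d∈ , refl with ∈-filter⁻ chosen? {xs = divisors n} d∈
    ...   | _ , j , j<t , refl , cj with hasValuation-unique {j} {k} (valuation-left j<t) w
    ...     | refl = ¬ck (j<t , cj)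

  -- Below `t` the heap `n` has no digit and the chosen powers produce `c`; at `t` the digit of `n`
  -- cancels against `c t`; above `t` everything vanishes.
  digits-chosen : LeadingAt c t → ∀ k →
                  digits (map (n ∸_) chosen) k ≡ does (hasValuation? k n) xor c k
  digits-chosen (ct , c>t) k with <-cmp k t
  ... | tri< k<t k≢t _ rewrite dec-false (hasValuation? k n) (k≢t ∘ λ w → hasValuation-unique {k} w v)
    with c k in ck
  ...   | true  = digits-chosen-true k<t ck
  ...   | false = digits-chosen-false λ (_ , ck′) → contradiction (trans (sym ck) ck′) λ ()
  digits-chosen (ct , c>t) k | tri≈ k≮t refl _ rewrite dec-true (hasValuation? k n) v | ct =
    digits-chosen-false (k≮t ∘ proj₁)
  digits-chosen (ct , c>t) k | tri> k≮t k≢t t<k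
    rewrite dec-false (hasValuation? k n) (k≢t ∘ λ w → hasValuation-unique {k} w v) | c>t t<k =
    digits-chosen-false (k≮t ∘ proj₁)

  heapOptions-toggle : LeadingAt c t →
    ∃[ r ] r ∈ heapOptions n × (∀ k → digits r k ≡ does (hasValuation? k n) xor c k)
  heapOptions-toggle lead with filter∈nonemptySublists chosen? (divisors n)
  ... | inj₂ S∈ = map (n ∸_) chosen , ∈-heapOptions⁺ n>0 S∈ , digits-chosen lead
  -- An empty choice is not a move. The divisor `n` itself is used instead: it leaves the heap 0,
  -- whose digits are those of the empty position.
  ... | inj₁ S≡[] =
    [ n ∸ n ] , ∈-heapOptions⁺ n>0 (singleton∈nonemptySublists (∈-divisors⁺ n>0 n>0 ∣-refl)) ,
    λ k → trans (digits-[n∸n] k)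
            (trans (cong (λ S → digits (map (n ∸_) S) k) (sym S≡[])) (digits-chosen lead k))
    where
    digits-[n∸n] : ∀ k → digits [ n ∸ n ] k ≡ false
    digits-[n∸n] k rewrite n∸n≡0 n = parity-none (hasValuation? k) [ 0 ] λ where
      (here refl) (_ , ∤0) → ∤0 ((2 ^ suc k) ∣0)

-- Digit `t` being 1, an odd number of heaps, hence at least one, has valuation `t`; the move is
-- made at the first of them.
options-toggle : ∀ p {t c} → digits p t ≡ true → LeadingAt c t →
  ∃[ q ] q ∈ options p × (∀ k → digits q k ≡ (digits p ⊕ c) k)
options-toggle (n ∷ hs) {t} {c} dt lead with hasValuation? t n
... | yes v = let r , r∈ , eq = heapOptions-toggle v c lead in
  r ++ hs , ∈-++⁺ˡ (∈-map⁺ (_++ hs) r∈) , λ k → begin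
    digits (r ++ hs) k                                   ≡⟨ digits-++ r hs k ⟩
    digits r k xor digits hs k                           ≡⟨ cong (_xor digits hs k) (eq k) ⟩
    (does (hasValuation? k n) xor c k) xor digits hs k   ≡⟨ xor-assoc (does (hasValuation? k n)) _ _ ⟩
    does (hasValuation? k n) xor (c k xor digits hs k)   ≡⟨ cong (does (hasValuation? k n) xor_) (xor-comm (c k) _) ⟩
    does (hasValuation? k n) xor (digits hs k xor c k)   ≡⟨ xor-assoc (does (hasValuation? k n)) _ _ ⟨
    (does (hasValuation? k n) xor digits hs k) xor c k   ∎
  where open ≡-Reasoning
... | no ¬v = let q , q∈ , eq = options-toggle hs dt′ lead in
  n ∷ q , ∈-++⁺ʳ (map (_++ hs) (heapOptions n)) (∈-map⁺ (n ∷_) q∈) ,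
  λ k → trans (cong (does (hasValuation? k n) xor_) (eq k))
              (sym (xor-assoc (does (hasValuation? k n)) (digits hs k) (c k)))
  where
  dt′ : digits hs t ≡ true
  dt′ = trans (cong (_xor digits hs t) (sym (dec-false (hasValuation? t n) ¬v))) dt

xor-cancelʳ : ∀ x y {z} → x xor z ≡ y xor z → x ≡ y
xor-cancelʳ true  true  _ = refl
xor-cancelʳ false false _ = refl
xor-cancelʳ true  false {true}  ()
xor-cancelʳ true  false {false} ()
xor-cancelʳ false true  {true}  ()
xor-cancelʳ false true  {false} ()

xor-cancelˡ : ∀ x {y z} → x xor y ≡ x xor z → y ≡ z
xor-cancelˡ true  = not-injective
xor-cancelˡ false = λ eq → eq

-- Sprague-Grundy values of sums of heaps

module _ (K : ℕ) where

  -- Positive heaps below `2 ^ K` have valuation below `K`, so `K` digits describe such a position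
  -- and, as moves only shrink heaps, all its followers.
  Bounded : Position → Set
  Bounded = All (_< 2 ^ K)

  options-bounded : ∀ {p q} → Bounded p → q ∈ options p → Bounded q
  options-bounded {n ∷ hs} (n< ∷ hs<) q∈ with ∈-++⁻ (map (_++ hs) (heapOptions n)) q∈
  ... | inj₁ q∈ˡ with ∈-map⁻ (_++ hs) q∈ˡ
  ...   | r , r∈ , refl = ++⁺ (All.tabulate bounded) hs<
    where
    bounded : ∀ {h} → h ∈ r → h < 2 ^ K
    bounded h∈ with ∈-heapOptions⁻ n r∈ h∈
    ... | d , _ , refl = ≤-<-trans (m∸n≤m n d) n<
  options-bounded {n ∷ hs} (n< ∷ hs<) q∈ | inj₂ q∈ʳ with ∈-map⁻ (n ∷_) q∈ʳ
  ... | _ , r∈ , refl = n< ∷ options-bounded hs< r∈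

  -- The witness is the valuation of the heap moved at: that heap contributes 1 to this digit, its
  -- replacement contributes 0, and all other heaps cancel.
  options-change : ∀ {p q} → Bounded p → q ∈ options p →
                   ∃[ k ] k < K × digits q k ≢ digits p k
  options-change {n ∷ hs} (n< ∷ hs<) q∈ with ∈-++⁻ (map (_++ hs) (heapOptions n)) q∈
  options-change {zero ∷ hs}    _ q∈ | inj₁ ()
  options-change {n@(suc _) ∷ hs} (n< ∷ hs<) q∈ | inj₁ q∈ˡ
    -- A positive `n` below `2 ^ K` is not divisible by `2 ^ K`, which bounds its valuation.
    with ∈-map⁻ (_++ hs) q∈ˡ | hasValuation-exists K (>⇒∤ n<)
  ... | r , r∈ , refl | k , k<K , v = k , k<K , λ eq →
    contradiction
      (trans (sym (heapOptions-clears {p = k} v r∈))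
        (trans (xor-cancelʳ (digits r k) (does (hasValuation? k n)) (trans (sym (digits-++ r hs k)) eq))
          (dec-true (hasValuation? k n) v)))
      λ ()
  options-change {n ∷ hs} (n< ∷ hs<) q∈ | inj₂ q∈ʳ with ∈-map⁻ (n ∷_) q∈ʳ
  ... | _ , r∈ , refl = let k , k<K , q≢ = options-change hs< r∈ in
    k , k<K , q≢ ∘ xor-cancelˡ (does (hasValuation? k n))

  -- Induction along moves, over all sums because a single heap moves to sums. Every option has
  -- another value by `options-change`, and each smaller value is reached by `toggle-to-smaller` and
  -- `options-toggle`.
  SG≡fromBits : ∀ p → Acc _isOptionOf_ p → Bounded p → SG p ≡ fromBits K (digits p)
  SG≡fromBits p (acc rs) p< = trans (SG-mex p) (mex-unique value∉ smaller∈)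
    where
    SG-option : ∀ {q} → q ∈ options p → SG q ≡ fromBits K (digits q)
    SG-option {q} q∈ = SG≡fromBits q (rs q∈) (options-bounded p< q∈)

    value∉ : fromBits K (digits p) ∉ map SG (options p)
    value∉ v∈ with ∈-map⁻ SG v∈
    ... | q , q∈ , eq = let k , k<K , q≢ = options-change p< q∈ in
      q≢ (sym (fromBits-injective K (trans eq (SG-option q∈)) k<K))

    smaller∈ : ∀ {x} → x < fromBits K (digits p) → x ∈ map SG (options p)
    smaller∈ x< =
      let t , c , dt , lead , _ , eq = toggle-to-smaller K (digits p) x<
          q , q∈ , dq = options-toggle p dt lead
      in subst (_∈ map SG (options p))
           (trans (SG-option q∈) (trans (fromBits-cong K λ {k} _ → dq k) eq))
           (∈-map⁺ SG q∈)

-- Single heaps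

n<2^n : ∀ n → n < 2 ^ n
n<2^n zero    = n<1+n 0
n<2^n (suc n) = ≤-<-trans (n<2^n n) (2^-<-suc n)

SG-heap : ∀ {n p} → HasValuation p n → SG [ n ] ≡ 2 ^ p
SG-heap {n} {p} v =
  trans (SG≡fromBits K [ n ] (isOptionOf-wellFounded [ n ]) (n< ∷ []))
    (fromBits-single K (m≤n+m (suc p) n) (digit p (dec-true (hasValuation? p n) v))
      λ {k} k≢p → digit k (dec-false (hasValuation? k n) λ w → k≢p (hasValuation-unique w v)))
  where
  -- Large enough for both `n < 2 ^ K` and `p < K`.
  K = n + suc p
  n< : n < 2 ^ K
  n< = <-≤-trans (n<2^n n) (^-monoʳ-≤ 2 (m≤m+n n (suc p)))
  digit : ∀ k {b} → does (hasValuation? k n) ≡ b → digits [ n ] k ≡ b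
  digit k eq = trans (xor-identityʳ _) eq

mainTheorem15 : SG [ 0 ] ≡ 0 ×
    (∀ (n p : ℕ) → 1 ≤ n →
    2 ^ p ∣ n → (∀ (q : ℕ) → 2 ^ q ∣ n → 2 ^ q ≤ 2 ^ p) →
    SG [ n ] ≡ 2 ^ p)
-- The heap 0 has no options, so its mex computes to 0. For `n`, maximality at exponent `suc p`
-- rules out that `2 ^ suc p` divides `n`.
mainTheorem15 = SG-mex [ 0 ] , λ n p _ 2^p∣n maximal →
  SG-heap {p = p} (2^p∣n , λ 2^1+p∣n → <⇒≱ (2^-<-suc p) (maximal (suc p) 2^1+p∣n))
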